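{- For every integer $k\ge 1$, there are only finitely many $k$-vertex-critical $(2P_2,bull)$-free graphs.
   Context: Graphs are finite and simple, and "finitely many" means up to isomorphism. A graph $G$ is $k$-vertex-critical if $\chi(G)=k$ and $\chi(G-v)<k$ for all $v\in V(G)$, where $\chi$ denotes the chromatic number. A graph is $(H_1,H_2)$-free if it contains no induced subgraph isomorphic to $H_1$ or $H_2$. $P_n$ is the path on $n$ vertices and $2P_2$ is the disjoint union of two copies of $P_2$ (two disjoint edges with no edges between them). The $bull$ is the 5-vertex graph obtained from a triangle $K_3$ by attaching two leaves (pendant vertices), each to a different vertex of the triangle. -}

module Defs where

open import Data.Fin using (Fin; toℕ; splitAt; punchIn; #_)
open import Data.Fin.Properties using (punchIn-injective) renaming (_≟_ to _≟ᶠ_)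
open import Data.List using (List; []; _∷_)
open import Data.List.Membership.Propositional using (_∈_)
open import Data.List.Relation.Unary.Any using (Any)
open import Data.Nat using (ℕ; suc; pred; _+_; _≤_; _<_)
open import Data.Nat.Properties using (1+n≢n) renaming (_≟_ to _≟ⁿ_)
open import Data.Product using (Σ; ∃; ∃-syntax; _×_; _,_; proj₁; proj₂)
open import Data.Product.Properties using (≡-dec)
open import Data.Sum using (_⊎_; inj₁; inj₂; swap)
open import Data.Sum.Relation.Binary.Pointwise
  using (Pointwise; ⊎-symmetric; ⊎-decidable; inj₁; inj₂)
open import Function.Bundles using (_↣_; _↔_; _⇔_; mk↣; Injection; Inverse)
open import Level using (0ℓ)
open import Relation.Binary.Core using (Rel)
open import Relation.Binary.Definitions using (Decidable; Symmetric; Irreflexive)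
open import Relation.Binary.PropositionalEquality using (_≡_; _≢_; refl; sym; cong)
open import Relation.Nullary using (¬_; ¬?; _×-dec_; _⊎-dec_)
import Data.List.Membership.DecPropositional as DecMembership

-- A finite simple graph on the vertex set Fin n.  Adjacency is required to be
-- decidable, as is implicit classically.
record Graph (n : ℕ) : Set₁ where
  field
    Adj          : Rel (Fin n) 0ℓ
    adj?         : Decidable Adj
    symmetric    : Symmetric Adj
    irreflexive  : Irreflexive _≡_ Adj

open Graph public

infix 4 _≅_

_≅_ : ∀ {m n} → Graph m → Graph n → Set
_≅_ {m} {n} G H = Σ (Fin m ↔ Fin n) λ φ →
  ∀ u v → Adj G u v ⇔ Adj H (Inverse.to φ u) (Inverse.to φ v)

-- The subgraph of G induced by the image of f, its vertices being named by Fin m.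
induced : ∀ {m n} → Graph n → Fin m ↣ Fin n → Graph m
induced G f = record
  { Adj         = λ u v → Adj G (to u) (to v)
  ; adj?        = λ u v → adj? G (to u) (to v)
  ; symmetric   = symmetric G
  ; irreflexive = λ u≡v → irreflexive G (cong to u≡v)
  }
  where open Injection f using (to)

-- punchIn v enumerates the vertices other than v.
infixl 6 _-_

_-_ : ∀ {n} → Graph n → Fin n → Graph (pred n)
_-_ {suc n} G v = induced G (mk↣ (λ {i} {j} → punchIn-injective v i j))

infix 4 _-Free

_-Free : ∀ {m} → Graph m → ∀ {n} → Graph n → Set
(H -Free) {n} G = ¬ (∃[ m ] Σ (Fin m ↣ Fin n) λ f → induced G f ≅ H)

⟨_,_⟩-Free : ∀ {l m} → Graph l → Graph m → ∀ {n} → Graph n → Set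
⟨ H₁ , H₂ ⟩-Free G = (H₁ -Free) G × (H₂ -Free) G

Colourable : ∀ {n} → Graph n → ℕ → Set
Colourable {n} G k = Σ (Fin n → Fin k) λ c → ∀ u v → Adj G u v → c u ≢ c v

-- The chromatic number, as a relation: the least number of colours of a proper
-- colouring.
infix 4 χ⟨_⟩≡_ χ⟨_⟩<_

χ⟨_⟩≡_ : ∀ {n} → Graph n → ℕ → Set
χ⟨ G ⟩≡ k = Colourable G k × (∀ j → Colourable G j → k ≤ j)

χ⟨_⟩<_ : ∀ {n} → Graph n → ℕ → Set
χ⟨ G ⟩< k = ∃[ j ] (χ⟨ G ⟩≡ j) × j < k

VertexCritical : ℕ → ∀ {n} → Graph n → Set
VertexCritical k G = (χ⟨ G ⟩≡ k) × (∀ v → χ⟨ G - v ⟩< k)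

-- The listed graphs need not themselves satisfy P.
FinitelyManyUpToIso : (∀ {n} → Graph n → Set) → Set₁
FinitelyManyUpToIso P = Σ (List (∃ Graph)) λ Gs →
  ∀ {n} (G : Graph n) → P G → Any (λ H → G ≅ proj₂ H) Gs

path : ∀ n → Graph n
path n = record
  { Adj         = λ i j → suc (toℕ i) ≡ toℕ j ⊎ suc (toℕ j) ≡ toℕ i
  ; adj?        = λ i j → (suc (toℕ i) ≟ⁿ toℕ j) ⊎-dec (suc (toℕ j) ≟ⁿ toℕ i)
  ; symmetric   = swap
  ; irreflexive = λ { refl (inj₁ eq) → 1+n≢n eq ; refl (inj₂ eq) → 1+n≢n eq }
  }

infixr 5 _⊕_

-- Disjoint union: splitAt m identifies Fin (m + n) with Fin m ⊎ Fin n, and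
-- Pointwise relates no vertex on the left to a vertex on the right.
_⊕_ : ∀ {m n} → Graph m → Graph n → Graph (m + n)
_⊕_ {m} {n} G H = record
  { Adj         = λ i j → _~_ (splitAt m i) (splitAt m j)
  ; adj?        = λ i j → ⊎-decidable (adj? G) (adj? H) (splitAt m i) (splitAt m j)
  ; symmetric   = ⊎-symmetric (symmetric G) (symmetric H)
  ; irreflexive = λ { {i} refl → loopless (splitAt m i) }
  }
  where
  _~_ : Rel (Fin m ⊎ Fin n) 0ℓ
  _~_ = Pointwise (Adj G) (Adj H)

  loopless : ∀ x → ¬ (x ~ x)
  loopless (inj₁ u) (inj₁ u~u) = irreflexive G refl u~u
  loopless (inj₂ v) (inj₂ v~v) = irreflexive H refl v~v

-- Pairs are read as unordered edges; pairs (i , i) are ignored.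
fromEdges : ∀ {n} → List (Fin n × Fin n) → Graph n
fromEdges es = record
  { Adj         = λ i j → i ≢ j × ((i , j) ∈ es ⊎ (j , i) ∈ es)
  ; adj?        = λ i j → ¬? (i ≟ᶠ j) ×-dec (((i , j) ∈? es) ⊎-dec ((j , i) ∈? es))
  ; symmetric   = λ (i≢j , e) → (λ j≡i → i≢j (sym j≡i)) , swap e
  ; irreflexive = λ i≡j (i≢j , _) → i≢j i≡j
  }
  where open DecMembership (≡-dec _≟ᶠ_ _≟ᶠ_) using (_∈?_)

2P₂ : Graph 4
2P₂ = path 2 ⊕ path 2

-- Triangle 0 1 2, with leaf 3 attached to 0 and leaf 4 attached to 1.
bull : Graph 5
bull = fromEdges
  ( (# 0 , # 1) ∷ (# 0 , # 2) ∷ (# 1 , # 2)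
  ∷ (# 0 , # 3) ∷ (# 1 , # 4) ∷ [] )

{-# OPTIONS --safe #-}

-- Fix a proper k-colouring of a k-vertex-critical (2P₂, bull)-free graph.  By
-- 2P₂-freeness the vertices of one colour class have nested neighbourhoods in
-- any independent set, and by criticality non-adjacent vertices have
-- incomparable neighbourhoods.  To a vertex s attach its colour together with
-- the set of all colour pairs (c , d) such that, for some s' of the colour of s,
-- a vertex of colour c sees s' but not s and one of colour d sees s but not s'.
-- If distinct s₁ and s₂ had the same data, the pair (c , d) arising from s₁ and
-- s₂ would also arise from s₂ and some s₃; nestedness then gives t ~ s₂ , s₃ and
-- u ~ s₁ , s₂ with t ≁ s₁ and u ≁ s₃, where t ~ u by 2P₂-freeness, so
-- s₁, u, t, s₃ and s₂ induce a bull.  Hence there are at most k * 2 ^ (k * k)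
-- vertices.
module Submission where

open import Defs
open import Data.Bool using (if_then_else_)
open import Data.Empty using (⊥)
open import Data.Fin
  using (Fin; zero; suc; punchOut; combine; remQuot; funToFin; finToFun; #_; _<_)
open import Data.Fin.Properties
  using (any?; all?; _<?_; <-cmp; injective⇒≤; combine-injective; remQuot-combine;
         finToFun-funToFin; punchIn-punchOut)
  renaming (_≟_ to _≟ᶠ_)
open import Data.List using (List; []; _∷_; allFin; cartesianProduct; concatMap; filter; map; upTo)
open import Data.List.Membership.Propositional using (_∈_; lose)
open import Data.List.Membership.Propositional.Properties
  using (∈-allFin; ∈-cartesianProduct⁺; ∈-filter⁺; ∈-filter⁻; ∈-concatMap⁺; ∈-map⁺; ∈-upTo⁺)
open import Data.List.Relation.Unary.All using (All; []; _∷_) renaming (lookup to lookupAll)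
open import Data.Nat using (ℕ; suc; _≥_; _≤_; _*_; _^_; s≤s)
open import Data.Nat.Properties using (<⇒≱)
open import Data.Product using (∃; ∃-syntax; _×_; _,_; proj₂; uncurry)
open import Data.Sum using (inj₁; [_,_])
open import Data.Vec using (_∷_; []; lookup)
open import Function using (_∘_)
open import Function.Bundles using (_⇔_; mk⇔; mk↣; Equivalence)
open import Function.Construct.Identity using (↔-id)
open import Level using (0ℓ)
open import Relation.Binary.Core using (REL)
open import Relation.Binary.Definitions using (Decidable; Tri; tri<; tri≈; tri>)
open import Relation.Binary.PropositionalEquality
  using (_≡_; _≢_; refl; sym; trans; cong; subst; subst₂)
open import Relation.Nullary
  using (¬_; Dec; does; yes; no; contradiction; ¬?; _×-dec_; _→-dec_; from-yes; decidable-stable)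

open Equivalence using (to; from)

-- Finiteness from a bound on the order, by coding relations as bit strings.

code : ∀ {m n} {R : REL (Fin m) (Fin n) 0ℓ} → Decidable R → Fin (2 ^ (m * n))
code {n = n} R? = funToFin (λ p → if does (uncurry R? (remQuot n p)) then # 1 else # 0)

decoded : ∀ {m n} → Fin (2 ^ (m * n)) → REL (Fin m) (Fin n) 0ℓ
decoded e i j = finToFun e (combine i j) ≡ # 1

decoded? : ∀ {m n} (e : Fin (2 ^ (m * n))) → Decidable (decoded {m} {n} e)
decoded? e i j = finToFun e (combine i j) ≟ᶠ # 1

decoded-code : ∀ {m n} {R : REL (Fin m) (Fin n) 0ℓ} (R? : Decidable R) i j →
  decoded (code R?) i j ⇔ R i j
decoded-code R? i j = mk⇔ (bit (R? i j) ∘ trans (sym value)) (trans value ∘ bit⁻¹ (R? i j))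
  where
  value : finToFun (code R?) (combine i j) ≡ (if does (R? i j) then # 1 else # 0)
  value = trans (finToFun-funToFin _ (combine i j))
    (cong (λ p → if does (uncurry R? p) then # 1 else # 0) (remQuot-combine i j))

  bit : ∀ {P : Set} (P? : Dec P) → (if does P? then # 1 else # 0) ≡ suc {1} zero → P
  bit (yes p) _ = p

  bit⁻¹ : ∀ {P : Set} (P? : Dec P) → P → (if does P? then # 1 else # 0) ≡ suc {1} zero
  bit⁻¹ (yes _) _ = refl
  bit⁻¹ (no ¬p) p = contradiction p ¬p

edges : ∀ {n} → Fin (2 ^ (n * n)) → List (Fin n × Fin n)
edges {n} e = filter (uncurry (decoded? e)) (cartesianProduct (allFin n) (allFin n))

decode : ∀ {n} → Fin (2 ^ (n * n)) → Graph n
decode = fromEdges ∘ edges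

encode : ∀ {n} → Graph n → Fin (2 ^ (n * n))
encode G = code (adj? G)

∈-edges-encode : ∀ {n} (G : Graph n) u v → (u , v) ∈ edges (encode G) ⇔ Adj G u v
∈-edges-encode {n} G u v = mk⇔
  (λ uv∈ → to adjacent (proj₂ (∈-filter⁻ edge? {xs = cartesianProduct (allFin n) (allFin n)} uv∈)))
  (λ u~v → ∈-filter⁺ edge? (∈-cartesianProduct⁺ (∈-allFin u) (∈-allFin v)) (from adjacent u~v))
  where
  edge? = uncurry (decoded? {n} {n} (encode G))

  adjacent = decoded-code (adj? G) u v

-- `fromEdges` symmetrises and discards loops, which changes nothing for a symmetric irreflexive
-- relation; so the identity on vertices is an isomorphism.
decode-encode : ∀ {n} (G : Graph n) → G ≅ decode (encode G)
decode-encode G = ↔-id _ , λ u v → mk⇔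
  (λ u~v → (λ u≡v → irreflexive G u≡v u~v) , inj₁ (from (∈-edges-encode G u v) u~v))
  (λ (_ , e) → [ to (∈-edges-encode G u v) , symmetric G ∘ to (∈-edges-encode G v u) ] e)

bounded⇒finite : (P : ∀ {n} → Graph n → Set) (N : ℕ) →
  (∀ {n} (G : Graph n) → P G → n ≤ N) → FinitelyManyUpToIso P
bounded⇒finite P N bound = concatMap graphs (upTo (suc N)) , λ {n} G PG →
  lose
    (∈-concatMap⁺ graphs (lose (∈-upTo⁺ (s≤s (bound G PG))) (∈-map⁺ _ (∈-allFin (encode G)))))
    (decode-encode G)
  where
  graphs : ℕ → List (∃ Graph)
  graphs n = map (λ e → n , decode e) (allFin (2 ^ (n * n)))

-- Recognising a fixed graph as an induced subgraph.

TwinFree : ∀ {m} → Graph m → Set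
TwinFree H = ∀ i j → (∀ l → (Adj H i l → Adj H j l) × (Adj H j l → Adj H i l)) → i ≡ j

twinFree? : ∀ {m} (H : Graph m) → Dec (TwinFree H)
twinFree? H = all? λ i → all? λ j →
  (all? λ l → (adj? H i l →-dec adj? H j l) ×-dec (adj? H j l →-dec adj? H i l)) →-dec (i ≟ᶠ j)

increasingPairs : ∀ m → List (Fin m × Fin m)
increasingPairs m = filter (uncurry _<?_) (cartesianProduct (allFin m) (allFin m))

infix 4 _⊨_at_

-- For a concrete `H` this evaluates to one edge or non-edge per pair i < j, in lexicographic order,
-- so that a proof is a plain list.
_⊨_at_ : ∀ {m n} → Graph n → Graph m → (Fin m → Fin n) → Set
_⊨_at_ {m} G H g = All
  (λ (i , j) → if does (adj? H i j) then Adj G (g i) (g j) else (¬ Adj G (g i) (g j)))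
  (increasingPairs m)

⊨⇒⇔ : ∀ {m n} (G : Graph n) (H : Graph m) g → G ⊨ H at g →
  ∀ i j → Adj G (g i) (g j) ⇔ Adj H i j
⊨⇒⇔ G H g table i j = by-order (<-cmp i j)
  where
  below : ∀ {i j} → i < j → Adj G (g i) (g j) ⇔ Adj H i j
  below {i} {j} i<j
    with adj? H i j
       | lookupAll table
           (∈-filter⁺ (uncurry _<?_) (∈-cartesianProduct⁺ (∈-allFin i) (∈-allFin j)) i<j)
  ... | yes i~j | a  = mk⇔ (λ _ → i~j) (λ _ → a)
  ... | no ¬i~j | ¬a = mk⇔ (λ a → contradiction a ¬a) (λ i~j → contradiction i~j ¬i~j)

  by-order : Tri (i < j) (i ≡ j) (j < i) → Adj G (g i) (g j) ⇔ Adj H i j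
  by-order (tri< i<j _ _)  = below i<j
  by-order (tri≈ _ refl _) = mk⇔
    (λ a → contradiction a (irreflexive G refl))
    (λ a → contradiction a (irreflexive H refl))
  by-order (tri> _ _ j<i)  = mk⇔
    (symmetric H ∘ to (below j<i) ∘ symmetric G)
    (symmetric G ∘ from (below j<i) ∘ symmetric H)

-- Without twins in H, distinctness of the vertices g i is automatic.
⊨⇒¬Free : ∀ {m n} (G : Graph n) (H : Graph m) → TwinFree H →
  ∀ g → G ⊨ H at g → ¬ (H -Free) G
⊨⇒¬Free G H twinFree g table free = free (_ , mk↣ injective , ↔-id _ , equiv)
  where
  equiv = ⊨⇒⇔ G H g table

  transfer : ∀ {i j} l → g i ≡ g j → Adj H i l → Adj H j l
  transfer l eq a = to (equiv _ l) (subst (λ x → Adj G x (g l)) eq (from (equiv _ l) a))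

  injective : ∀ {i j} → g i ≡ g j → i ≡ j
  injective eq = twinFree _ _ (λ l → transfer l eq , transfer l (sym eq))

module _ {n} (G : Graph n) where

  private
    infix 4 _~_ _≁_

    _~_ _≁_ : Fin n → Fin n → Set
    _~_ = Adj G
    u ≁ v = ¬ Adj G u v

  2P₂-free⇒adjacent : (2P₂ -Free) G → ∀ {a b c d} →
    a ~ b → c ~ d → a ≁ c → a ≁ d → b ≁ c → b ~ d
  2P₂-free⇒adjacent free {a} {b} {c} {d} a~b c~d a≁c a≁d b≁c =
    decidable-stable (adj? G b d) λ b≁d →
      ⊨⇒¬Free G 2P₂ (from-yes (twinFree? 2P₂)) (lookup (a ∷ b ∷ c ∷ d ∷ []))
        (a~b ∷ a≁c ∷ a≁d ∷ b≁c ∷ b≁d ∷ c~d ∷ []) free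

  -- The triangle is `a`, `b`, `c`; the leaf `d` hangs on `a` and the leaf `e` on `b`.
  bull-free⇒ : (bull -Free) G → ∀ {a b c d e} →
    a ~ b → a ~ c → a ~ d → a ≁ e → b ~ c → b ≁ d → b ~ e → c ≁ d → c ≁ e → d ≁ e → ⊥
  bull-free⇒ free {a} {b} {c} {d} {e} ab ac ad ae bc bd be cd ce de =
    ⊨⇒¬Free G bull (from-yes (twinFree? bull)) (lookup (a ∷ b ∷ c ∷ d ∷ e ∷ []))
      (ab ∷ ac ∷ ad ∷ ae ∷ bc ∷ bd ∷ be ∷ cd ∷ ce ∷ de ∷ []) free

-- Neighbourhoods in vertex-critical graphs.

homomorphism-avoiding⇒colourable : ∀ {n j} (G : Graph n) v (h : Fin n → Fin n) →
  (∀ x y → Adj G x y → Adj G (h x) (h y)) → (∀ x → v ≢ h x) →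
  Colourable (G - v) j → Colourable G j
homomorphism-avoiding⇒colourable {suc n} G v h hom avoids (c , proper) =
  (λ x → c (punchOut (avoids x))) , λ x y x~y → proper _ _
    (subst₂ (Adj G) (sym (punchIn-punchOut (avoids x))) (sym (punchIn-punchOut (avoids y)))
      (hom x y x~y))

-- Otherwise every neighbour of `v` is one of `w`, and folding `v` onto `w` maps `G` homomorphically
-- into `G - v`. A colouring of `G - v` with fewer than `k` colours then pulls back to `G`.
critical⇒incomparable : ∀ {n k} (G : Graph n) → VertexCritical k G →
  ∀ {v w} → v ≢ w → ¬ Adj G v w → ∃[ t ] Adj G t v × ¬ Adj G t w
critical⇒incomparable {n} G ((_ , minimal) , critical) {v} {w} v≢w v≁w
  with any? (λ t → adj? G t v ×-dec ¬? (adj? G t w))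
... | yes t = t
... | no ∄t with j , (colourable , _) , j<k ← critical v =
  contradiction
    (minimal j (homomorphism-avoiding⇒colourable G v h hom avoids colourable)) (<⇒≱ j<k)
  where
  h : Fin n → Fin n
  h x = if does (x ≟ᶠ v) then w else x

  N[v]⊆N[w] : ∀ {t} → Adj G t v → Adj G t w
  N[v]⊆N[w] {t} t~v = decidable-stable (adj? G t w) λ t≁w → ∄t (t , t~v , t≁w)

  hom : ∀ x y → Adj G x y → Adj G (h x) (h y)
  hom x y x~y with x ≟ᶠ v | y ≟ᶠ v
  ... | yes refl | yes refl = contradiction x~y (irreflexive G refl)
  ... | yes refl | no _     = symmetric G (N[v]⊆N[w] (symmetric G x~y))
  ... | no _     | yes refl = N[v]⊆N[w] x~y
  ... | no _     | no _     = x~y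

  avoids : ∀ x → v ≢ h x
  avoids x with x ≟ᶠ v
  ... | yes _  = v≢w
  ... | no x≢v = x≢v ∘ sym

-- Vertices are determined by their signatures.

module Signature {n k} (G : Graph n) (f : Fin n → Fin k) where

  infix 4 _⟨_∖_⟩_

  _⟨_∖_⟩_ : Fin n → Fin n → Fin n → Fin k → Set
  t ⟨ v ∖ w ⟩ c = f t ≡ c × Adj G t v × ¬ Adj G t w

  Split : Fin n → Fin k → Fin k → Set
  Split s c d = ∃[ s' ] f s ≡ f s' × (∃[ t ] t ⟨ s' ∖ s ⟩ c) × (∃[ u ] u ⟨ s ∖ s' ⟩ d)

  split? : ∀ s c d → Dec (Split s c d)
  split? s c d = any? λ s' → (f s ≟ᶠ f s') ×-dec separates? s' s c ×-dec separates? s s' d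
    where
    separates? : ∀ v w e → Dec (∃[ t ] t ⟨ v ∖ w ⟩ e)
    separates? v w e = any? λ t → (f t ≟ᶠ e) ×-dec adj? G t v ×-dec ¬? (adj? G t w)

  splits : Fin n → Fin (2 ^ (k * k))
  splits s = code (split? s)

  signature : Fin n → Fin (k * 2 ^ (k * k))
  signature s = combine (f s) (splits s)

  module _ (proper : ∀ u v → Adj G u v → f u ≢ f v) (critical : VertexCritical k G)
           (2P₂-free : (2P₂ -Free) G) (bull-free : (bull -Free) G) where

    same-colour⇒nonadjacent : ∀ {u v} → f u ≡ f v → ¬ Adj G u v
    same-colour⇒nonadjacent eq u~v = proper _ _ u~v eq

    -- If `t` missed `s'`, the edges `s t` and `s' t'` could be joined only by `t ~ t'`, which is
    -- excluded within one colour class.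
    nested : ∀ {t t' s s'} → f t ≡ f t' → f s ≡ f s' →
      Adj G t s → Adj G t' s' → ¬ Adj G t' s → Adj G t s'
    nested {t} {t'} {s} {s'} ft≡ft' fs≡fs' t~s t'~s' t'≁s =
      decidable-stable (adj? G t s') λ t≁s' →
        same-colour⇒nonadjacent ft≡ft'
          (2P₂-free⇒adjacent G 2P₂-free (symmetric G t~s) (symmetric G t'~s')
            (same-colour⇒nonadjacent fs≡fs') (t'≁s ∘ symmetric G) t≁s')

    -- The bull has triangle `u`, `t`, `s₂`, with leaf `s₁` at `u` and leaf `s₃` at `t`. The edge
    -- `u t` comes from 2P₂-freeness applied to `s₁ u` and `s₃ t`.
    no-three : ∀ {s₁ s₂ s₃ t u} → f s₁ ≡ f s₂ → f s₂ ≡ f s₃ →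
      Adj G t s₂ → Adj G t s₃ → ¬ Adj G t s₁ →
      Adj G u s₁ → Adj G u s₂ → ¬ Adj G u s₃ → ⊥
    no-three {s₁} {s₂} {s₃} {t} {u} eq₁₂ eq₂₃ t~s₂ t~s₃ t≁s₁ u~s₁ u~s₂ u≁s₃ =
      bull-free⇒ G bull-free u~t u~s₂ u~s₁ u≁s₃ t~s₂ t≁s₁ t~s₃
        (same-colour⇒nonadjacent (sym eq₁₂)) (same-colour⇒nonadjacent eq₂₃) s₁≁s₃
      where
      s₁≁s₃ = same-colour⇒nonadjacent (trans eq₁₂ eq₂₃)

      u~t : Adj G u t
      u~t = 2P₂-free⇒adjacent G 2P₂-free (symmetric G u~s₁) (symmetric G t~s₃)
        s₁≁s₃ (t≁s₁ ∘ symmetric G) u≁s₃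

    signature-injective : ∀ {s₁ s₂} → signature s₁ ≡ signature s₂ → s₁ ≡ s₂
    signature-injective {s₁} {s₂} eq
      with eq₁₂ , splits≡ ← combine-injective (f s₁) (splits s₁) (f s₂) (splits s₂) eq
      = decidable-stable (s₁ ≟ᶠ s₂) λ s₁≢s₂ →
        let
          (t , t~s₂ , t≁s₁) = critical⇒incomparable G critical (s₁≢s₂ ∘ sym)
                                (same-colour⇒nonadjacent (sym eq₁₂))
          (u , u~s₁ , u≁s₂) = critical⇒incomparable G critical s₁≢s₂
                                (same-colour⇒nonadjacent eq₁₂)
          -- Here `s₂` itself separates from `s₁` with the colours of `t` and `u`; equality of the
          -- codes carries this colour pair over to `s₂`, which yields `s₃`.
          split₁ = s₂ , eq₁₂ , (t , refl , t~s₂ , t≁s₁) , (u , refl , u~s₁ , u≁s₂)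
          (s₃ , eq₂₃ , (t' , ft'≡ft , t'~s₃ , t'≁s₂) , (u' , fu'≡fu , u'~s₂ , u'≁s₃)) =
            to (decoded-code (split? s₂) (f t) (f u))
              (subst (λ e → decoded e (f t) (f u)) splits≡
                (from (decoded-code (split? s₁) (f t) (f u)) split₁))
        in no-three eq₁₂ eq₂₃
             -- The bull uses `t` and `u'`: nestedness against `t'` gives that `t` sees `s₃`, and
             -- against `u` that `u'` sees `s₁`.
             t~s₂ (nested (sym ft'≡ft) eq₂₃ t~s₂ t'~s₃ t'≁s₂) t≁s₁
             (nested fu'≡fu (sym eq₁₂) u'~s₂ u~s₁ u≁s₂) u'~s₂ u'≁s₃

    order-bound : n ≤ k * 2 ^ (k * k)
    order-bound = injective⇒≤ signature-injective

theorem3p2 : (k : ℕ) → k ≥ 1 →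
    FinitelyManyUpToIso (λ G → VertexCritical k G × ⟨ 2P₂ , bull ⟩-Free G)
theorem3p2 k _ = bounded⇒finite _ (k * 2 ^ (k * k))
  λ { G (critical@(((f , proper) , _) , _) , 2P₂-free , bull-free) →
      Signature.order-bound G f proper critical 2P₂-free bull-free }
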